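{- Let $G$ be a generalised dihedral group of order $2n$ over the abelian group $A$, and let $\Gamma=\mathrm{Cay}(G,S)$. If $|S\cap xA|\le 1$ or $|S\cap xA|\ge n-1$, then $\Gamma$ is isomorphic to a Cayley graph on the abelian group $A\times C_2$, and therefore $\gamma_{\mathrm{all}}^\infty(\Gamma)=\gamma(\Gamma)$.
   Context: Groups and graphs are finite. For an abelian group $A$, the generalised dihedral group over $A$ is $G=\langle A,x : x^2=1,\ x^{ -1}ax=a^{ -1}\ \forall a\in A\rangle$, i.e. the semidirect product $A\rtimes\langle x\rangle$ with $x\notin A$ of order 2 acting by inversion; $xA$ is the nontrivial coset of $A$. For a group $G$ and an inverse-closed subset $S\subseteq G$, $\mathrm{Cay}(G,S)$ is the graph with vertex set $G$ and an edge from $u$ to $us$ for every $u\in G$, $s\in S$. The identity may be allowed in $S$ (giving a loop at every vertex); such loops are irrelevant to domination. $C_2$ is the cyclic group of order 2. A vertex $u$ dominates a vertex $w$ if $w=u$ or $w$ is adjacent to $u$. A dominating set is a set $D$ of vertices such that every vertex is dominated by at least one vertex of $D$; $\gamma(\Gamma)$ is the smallest size of a dominating set of $\Gamma$. Guards located at the vertices of a set $D$ (one guard per vertex) can reconfigure to a set $D'$ if there is a bijection $f:D\to D'$ such that for every $d\in D$, either $f(d)=d$ or $f(d)$ is adjacent to $d$. An eternal dominating configuration for $\Gamma$ is a nonempty collection $\mathcal D$ of subsets of $V(\Gamma)$, all of the same cardinality, such that for every $D_i\in\mathcal D$ and every vertex $w\notin D_i$ there is $D_j\in\mathcal D$ with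 $w\in D_j$ such that guards at $D_i$ can reconfigure to $D_j$. An eternal dominating set is a member of some eternal dominating configuration. The eternal domination number $\gamma_{\mathrm{all}}^\infty(\Gamma)$ is the smallest cardinality of an eternal dominating set. -}

module Defs where

open import Level using (Level; _⊔_; 0ℓ) renaming (suc to lsuc)
open import Algebra.Bundles using (Group; AbelianGroup)
open import Algebra.Construct.DirectProduct using () renaming (abelianGroup to _×ᴬ_)
import Algebra.Properties.AbelianGroup as AbelianGroupProperties
open import Data.Fin using (Fin)
open import Data.Fin.Patterns using (0F; 1F)
open import Data.Fin.Properties using (any?; *↔×) renaming (_≟_ to _≟ᶠ_)
open import Data.Fin.Subset using (Subset; ∣_∣) renaming (_∈_ to _∈ᶠ_)
open import Data.Nat using (ℕ; _≤_; _*_)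
open import Data.Parity using (Parity; 0ℙ; 1ℙ) renaming (_+_ to _+ℙ_)
import Data.Parity.Properties as ℙ
open import Data.Product using (∃; ∃-syntax; Σ; _×_; _,_; proj₁; proj₂)
open import Data.Product.Function.NonDependent.Setoid using (_×-inverse_)
open import Data.Product.Relation.Binary.Pointwise.NonDependent using (_×ₛ_; Pointwise-≡↔≡)
open import Data.Sum using (_⊎_)
open import Data.Vec using (tabulate)
open import Function.Bundles using (Inverse; Bijection; _⇔_; mk↔ₛ′)
import Function.Construct.Composition as Compose
import Function.Construct.Symmetry as Symmetry
open import Function.Properties.Inverse using (Inverse⇒Injection)
open import Relation.Binary.Bundles using (Setoid)
open import Relation.Binary.Core using (Rel)
open import Relation.Binary.Definitions using (Decidable; Symmetric; _Respects₂_)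
import Relation.Binary.Construct.On as On
open import Relation.Binary.PropositionalEquality as ≡ using (_≡_; refl)
open import Relation.Nullary using (¬_; does)
open import Relation.Nullary.Decidable using (via-injection)
open import Relation.Unary using (Pred)

private
  variable
    c ℓ c′ ℓ′ r r′ : Level

-- Finiteness of a setoid is an enumeration of its elements up to ≈.  Subsets
-- of the setoid are the library's subsets of the set of indices, so they
-- respect ≈ and have the library's cardinality.

record Finite (V : Setoid c ℓ) : Set (c ⊔ ℓ) where
  open Setoid V
  field
    size        : ℕ
    enumeration : Inverse V (≡.setoid (Fin size))

  open Inverse enumeration public using () renaming (to to index; from to element)

  infix 4 _∈_ _∉_ _≟_

  _∈_ : Carrier → Subset size → Set
  v ∈ D = index v ∈ᶠ D

  _∉_ : Carrier → Subset size → Set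
  v ∉ D = ¬ (v ∈ D)

  _≟_ : Decidable _≈_
  _≟_ = via-injection (Inverse⇒Injection enumeration) _≟ᶠ_

  Members : Subset size → Setoid c ℓ
  Members D = On.setoid V (proj₁ {B = _∈ D})

_×-finite_ : {V : Setoid c ℓ} {W : Setoid c′ ℓ′} →
             Finite V → Finite W → Finite (V ×ₛ W)
F ×-finite H = record
  { size        = F.size * H.size
  ; enumeration = Compose.inverse
      (Compose.inverse (F.enumeration ×-inverse H.enumeration) Pointwise-≡↔≡)
      (Symmetry.inverse *↔×)
  }
  where
  module F = Finite F
  module H = Finite H

-- Graphs may have loops; they affect neither domination nor reconfiguration.

record Graph c ℓ r : Set (lsuc (c ⊔ ℓ ⊔ r)) where
  infix 4 _~_
  field
    vertices : Setoid c ℓ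
    finite   : Finite vertices
  open Setoid vertices public using (_≈_) renaming (Carrier to Vertex)
  open Finite finite public
  field
    _~_    : Rel Vertex r
    ~-resp : _~_ Respects₂ _≈_
    ~-sym  : Symmetric _~_

  VertexSet : Set
  VertexSet = Subset size

record _≅_ (Γ : Graph c ℓ r) (Δ : Graph c′ ℓ′ r′) : Set (c ⊔ ℓ ⊔ r ⊔ c′ ⊔ ℓ′ ⊔ r′) where
  private
    module Γ = Graph Γ
    module Δ = Graph Δ
  field
    bijection : Inverse Γ.vertices Δ.vertices
  open Inverse bijection using (to)
  field
    adjacency : ∀ u v → (u Γ.~ v) ⇔ (to u Δ.~ to v)

module _ (Γ : Graph c ℓ r) where
  open Graph Γ

  Dominates : Rel Vertex (ℓ ⊔ r)
  Dominates u w = w ≈ u ⊎ u ~ w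

  IsDominating : VertexSet → Set (c ⊔ ℓ ⊔ r)
  IsDominating D = ∀ w → ∃[ u ] u ∈ D × Dominates u w

  CanReconfigure : VertexSet → VertexSet → Set (c ⊔ ℓ ⊔ r)
  CanReconfigure D D′ = Σ (Bijection (Members D) (Members D′)) λ f →
    ∀ d → let f⟨d⟩ = proj₁ (Bijection.to f d) in f⟨d⟩ ≈ proj₁ d ⊎ proj₁ d ~ f⟨d⟩

  record IsEternalDominatingConfiguration (𝒟 : Pred VertexSet 0ℓ) : Set (c ⊔ ℓ ⊔ r) where
    field
      nonempty        : ∃[ D ] 𝒟 D
      sameCardinality : ∀ D D′ → 𝒟 D → 𝒟 D′ → ∣ D ∣ ≡ ∣ D′ ∣
      defends         : ∀ D → 𝒟 D → ∀ w → w ∉ D →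
                        ∃[ D′ ] 𝒟 D′ × w ∈ D′ × CanReconfigure D D′

  IsEternalDominating : VertexSet → Set (c ⊔ ℓ ⊔ r ⊔ lsuc 0ℓ)
  IsEternalDominating D = ∃[ 𝒟 ] IsEternalDominatingConfiguration 𝒟 × 𝒟 D

  IsSmallestSize : Pred VertexSet r′ → ℕ → Set r′
  IsSmallestSize P k = (∃[ D ] P D × ∣ D ∣ ≡ k) × (∀ D → P D → k ≤ ∣ D ∣)

  -- The two numbers are given by their graphs: IsDominationNumber k says
  -- γ(Γ) = k, and IsEternalDominationNumber k says γ^∞_all(Γ) = k.  Each holds
  -- for at most one k.

  IsDominationNumber : ℕ → Set (c ⊔ ℓ ⊔ r)
  IsDominationNumber = IsSmallestSize IsDominating

  IsEternalDominationNumber : ℕ → Set (c ⊔ ℓ ⊔ r ⊔ lsuc 0ℓ)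
  IsEternalDominationNumber = IsSmallestSize IsEternalDominating

module _ (G : Group c ℓ) (F : Finite (Group.setoid G)) where
  open Group G renaming (sym to ≈-sym; trans to ≈-trans)
  open Finite F

  InverseClosed : Subset size → Set c
  InverseClosed S = ∀ s → s ∈ S → s ⁻¹ ∈ S

  Cay : (S : Subset size) → InverseClosed S → Graph c ℓ (c ⊔ ℓ)
  Cay S S⁻¹⊆S = record
    { vertices = setoid
    ; finite   = F
    ; _~_      = λ u v → ∃[ s ] s ∈ S × v ≈ u ∙ s
    ; ~-resp   = (λ v≈w (s , s∈S , v≈us) → s , s∈S , ≈-trans (≈-sym v≈w) v≈us)
               , (λ u≈w (s , s∈S , v≈us) → s , s∈S , ≈-trans v≈us (∙-congʳ u≈w))
    ; ~-sym    = λ {u} {v} (s , s∈S , v≈us) → s ⁻¹ , S⁻¹⊆S s s∈S , back u v s v≈us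
    }
    where
    back : ∀ u v s → v ≈ u ∙ s → u ≈ v ∙ s ⁻¹
    back u v s v≈us = ≈-sym (≈-trans (∙-congʳ v≈us)
      (≈-trans (assoc u s (s ⁻¹)) (≈-trans (∙-congˡ (inverseʳ s)) (identityʳ u))))

C₂ : AbelianGroup 0ℓ 0ℓ
C₂ = ℙ.+-0-abelianGroup

C₂-finite : Finite (AbelianGroup.setoid C₂)
C₂-finite = record
  { size        = 2
  ; enumeration = mk↔ₛ′ (λ { 0ℙ → 0F ; 1ℙ → 1F }) (λ { 0F → 0ℙ ; 1F → 1ℙ })
                        (λ { 0F → refl ; 1F → refl }) (λ { 0ℙ → refl ; 1ℙ → refl })
  }

module _ (A : AbelianGroup c ℓ) where
  open AbelianGroup A renaming (Carrier to ∣A∣; refl to ≈-refl; sym to ≈-sym; trans to ≈-trans)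
  open AbelianGroupProperties A using (⁻¹-∙-comm; ⁻¹-involutive; ε⁻¹≈ε)

  private
    act : Parity → ∣A∣ → ∣A∣
    act 0ℙ a = a
    act 1ℙ a = a ⁻¹

    act-cong : ∀ i {a b} → a ≈ b → act i a ≈ act i b
    act-cong 0ℙ = λ a≈b → a≈b
    act-cong 1ℙ = ⁻¹-cong

    act-∙ : ∀ i a b → act i (a ∙ b) ≈ act i a ∙ act i b
    act-∙ 0ℙ a b = ≈-refl
    act-∙ 1ℙ a b = ≈-sym (⁻¹-∙-comm a b)

    act-+ : ∀ i j a → act (i +ℙ j) a ≈ act i (act j a)
    act-+ 0ℙ j  a = ≈-refl
    act-+ 1ℙ 0ℙ a = ≈-refl
    act-+ 1ℙ 1ℙ a = ≈-sym (⁻¹-involutive a)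

    act-ε : ∀ i → act i ε ≈ ε
    act-ε 0ℙ = ≈-refl
    act-ε 1ℙ = ε⁻¹≈ε

    act-act : ∀ i a → act i (act i a) ≈ a
    act-act 0ℙ a = ≈-refl
    act-act 1ℙ a = ⁻¹-involutive a

  -- The semidirect product A ⋊ ⟨x⟩: the pair (a , i) stands for a xⁱ.

  GenDihedral : Group c ℓ
  GenDihedral = record
    { Carrier = ∣A∣ × Parity
    ; _≈_     = Setoid._≈_ (setoid ×ₛ ≡.setoid Parity)
    ; _∙_     = λ (a , i) (b , j) → a ∙ act i b , i +ℙ j
    ; ε       = ε , 0ℙ
    ; _⁻¹     = λ (a , i) → act i (a ⁻¹) , i
    ; isGroup = record
      { isMonoid = record
        { isSemigroup = record
          { isMagma = record
            { isEquivalence = Setoid.isEquivalence (setoid ×ₛ ≡.setoid Parity)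
            ; ∙-cong = λ { {_ , i} (a≈a′ , refl) (b≈b′ , refl) → ∙-cong a≈a′ (act-cong i b≈b′) , refl }
            }
          ; assoc = λ (a , i) (b , j) (d , k) →
              ≈-trans (assoc a (act i b) (act (i +ℙ j) d))
                (∙-congˡ (≈-trans (∙-congˡ (act-+ i j d)) (≈-sym (act-∙ i b (act j d)))))
              , ℙ.+-assoc i j k
          }
        ; identity = (λ (a , i) → identityˡ a , refl)
                   , (λ (a , i) → ≈-trans (∙-congˡ (act-ε i)) (identityʳ a) , ℙ.+-identityʳ i)
        }
      ; inverse = (λ (a , i) → ≈-trans (≈-sym (act-∙ i (a ⁻¹) a))
                                 (≈-trans (act-cong i (inverseˡ a)) (act-ε i))
                             , ℙ.p+p≡0ℙ i)
                , (λ (a , i) → ≈-trans (∙-congˡ (act-act i (a ⁻¹))) (inverseʳ a)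
                             , ℙ.p+p≡0ℙ i)
      ; ⁻¹-cong = λ { {_ , i} (a≈b , refl) → act-cong i (⁻¹-cong a≈b) , refl }
      }
    }

  private
    module G = Group GenDihedral

  -- ι embeds A; the lemmas after x are the defining relations of the internal
  -- semidirect product.

  ι : ∣A∣ → G.Carrier
  ι a = a , 0ℙ

  x : G.Carrier
  x = ε , 1ℙ

  ι-homo : ∀ a b → ι (a ∙ b) G.≈ ι a G.∙ ι b
  ι-homo a b = G.refl

  encoding : ∀ a → (a , 0ℙ) G.≈ ι a × (a , 1ℙ) G.≈ ι a G.∙ x
  encoding a = G.refl , (≈-sym (identityʳ a) , refl)

  x∙x≈ε : x G.∙ x G.≈ G.ε
  x∙x≈ε = ≈-trans (identityˡ (ε ⁻¹)) ε⁻¹≈ε , refl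

  x∉A : ∀ a → ¬ (x G.≈ ι a)
  x∉A a (_ , ())

  x-inverts-A : ∀ a → (x G.⁻¹ G.∙ ι a) G.∙ x G.≈ ι (a ⁻¹)
  x-inverts-A a =
    ≈-trans (∙-cong (≈-trans (∙-congʳ (⁻¹-involutive ε)) (identityˡ (a ⁻¹))) ε⁻¹≈ε)
            (identityʳ (a ⁻¹)) , refl

  module _ (F : Finite setoid) where

    GenDihedral-finite : Finite (Group.setoid GenDihedral)
    GenDihedral-finite = F ×-finite C₂-finite

    private
      module F = Finite F
      module GF = Finite GenDihedral-finite

    xA : Subset GF.size
    xA = tabulate λ i → does (any? λ j → GF.element i GF.≟ x G.∙ ι (F.element j))

A×C₂ : AbelianGroup c ℓ → AbelianGroup c ℓ
A×C₂ A = A ×ᴬ C₂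

A×C₂-finite : (A : AbelianGroup c ℓ) → Finite (AbelianGroup.setoid A) →
              Finite (AbelianGroup.setoid (A×C₂ A))
A×C₂-finite A F = F ×-finite C₂-finite

{-# OPTIONS --safe #-}

-- Translating xA by t turns Cay(A ⋊ ⟨x⟩, S) into a Cayley graph on A × C₂ as
-- soon as the A-part B of S ∩ xA satisfies (B t⁻¹)⁻¹ = B t⁻¹.  If B or its
-- complement is {b} then t = b works, and if B is ∅ or A then any t does.
--
-- On an abelian group, translation by s ∈ S is an automorphism moving every
-- vertex along an edge, so the guards of a dominating set can all follow the
-- guard which answers an attack: the dominating sets of minimum size form an
-- eternal dominating configuration.

module Submission where

open import Level using (Level)
open import Algebra.Bundles using (Group; AbelianGroup)
import Algebra.Properties.AbelianGroup as AbelianGroupProperties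
import Algebra.Properties.CommutativeSemigroup as CommutativeSemigroupProperties
import Algebra.Properties.Group as GroupProperties
open import Data.Fin using (Fin; zero; suc)
open import Data.Fin.Properties using (any?; all?; suc-injective) renaming (_≟_ to _≟ᶠ_)
open import Data.Fin.Subset using (Subset; inside; outside; ∣_∣; _∩_; _-_; ∁; ⊤)
  renaming (_∈_ to _∈ᶠ_)
open import Data.Fin.Subset.Properties using
  ( _∈?_; ∈⊤; ∣⊤∣≡n; nonempty?; anySubset?; x∈p∩q⁺; x∈∁p⇒x∉p; x∉p⇒x∈∁p
  ; x∈p∧x≢y⇒x∈p-y; x∈p⇒∣p-x∣<∣p∣ )
open import Data.Nat using (ℕ; _≤_; _≥_; _<_; _∸_; _+_; s≤s; z≤n; _<?_)
open import Data.Nat.Induction using (Acc; acc; <-wellFounded)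
open import Data.Nat.Properties as ℕ using ()
open import Data.Parity using (0ℙ; 1ℙ)
open import Data.Product using (_×_; _,_; proj₁; proj₂; ∃-syntax; Σ-syntax)
open import Data.Sum using (_⊎_; inj₁; inj₂)
import Data.Sum as Sum
open import Data.Vec using (_∷_; []; here; there; tabulate)
open import Data.Vec.Properties using (lookup∘tabulate; lookup⇒[]=; []=⇒lookup)
open import Function using (_∘_)
open import Function.Bundles using (Inverse; Injection; Bijection; Equivalence; _⇔_; mk⇔)
import Function.Construct.Composition as Compose
import Function.Construct.Symmetry as Symmetry
open import Function.Properties.Inverse using (Inverse⇒Injection)
open import Relation.Binary.Bundles using (Setoid)
open import Relation.Binary.Definitions using (Decidable; _Respects_)
open import Relation.Binary.PropositionalEquality as ≡ using (_≡_; refl)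
import Relation.Binary.Reasoning.Setoid as SetoidReasoning
open import Relation.Nullary using (Dec; yes; no; does; contradiction)
open import Relation.Nullary.Decidable
  using (map′; _⊎-dec_; _×-dec_; dec-true; True; toWitness; fromWitness; decidable-stable)
open import Relation.Unary as Unary using (Pred)
open import Defs

private
  variable
    c ℓ c′ ℓ′ c″ ℓ″ r r′ r″ p : Level
    m n : ℕ

-- Counting in finite subsets, and choosing a smallest one.

injection⇒∣∣-mono : (f : Fin m → Fin n) (P : Subset m) (Q : Subset n) →
                    (∀ {i} → i ∈ᶠ P → f i ∈ᶠ Q) →
                    (∀ {i j} → i ∈ᶠ P → j ∈ᶠ P → f i ≡ f j → i ≡ j) →
                    ∣ P ∣ ≤ ∣ Q ∣
injection⇒∣∣-mono f []            Q f∈ inj = z≤n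
injection⇒∣∣-mono f (outside ∷ P) Q f∈ inj =
  injection⇒∣∣-mono (f ∘ suc) P Q (f∈ ∘ there)
    (λ i∈ j∈ eq → suc-injective (inj (there i∈) (there j∈) eq))
injection⇒∣∣-mono f (inside ∷ P) Q f∈ inj = ℕ.≤-trans
  -- By injectivity the remaining values avoid `f zero`, so they fit into a set strictly smaller
  -- than `Q`.
  (s≤s (injection⇒∣∣-mono (f ∘ suc) P (Q - f zero)
    (λ i∈ → x∈p∧x≢y⇒x∈p-y (f∈ (there i∈)) (λ eq → contradiction (inj (there i∈) here eq) λ ()))
    (λ i∈ j∈ eq → suc-injective (inj (there i∈) (there j∈) eq))))
  (x∈p⇒∣p-x∣<∣p∣ (f∈ here))

-- If `i` and `j` differed, `i` would survive in `P - j`, giving `1 ≤ ∣ P - j ∣ < ∣ P ∣`.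
∣P∣≤1⇒unique : ∀ {P : Subset n} {i j} → ∣ P ∣ ≤ 1 → i ∈ᶠ P → j ∈ᶠ P → i ≡ j
∣P∣≤1⇒unique {P = P} {i} {j} ∣P∣≤1 i∈P j∈P = decidable-stable (i ≟ᶠ j) λ i≢j →
  ℕ.<⇒≱ (ℕ.≤-<-trans (ℕ.≤-trans (s≤s z≤n) (x∈p⇒∣p-x∣<∣p∣ (x∈p∧x≢y⇒x∈p-y i∈P i≢j)))
                     (x∈p⇒∣p-x∣<∣p∣ j∈P))
        ∣P∣≤1

∣P∩R∣+∣∁P∩R∣≡∣R∣ : (P R : Subset n) → ∣ P ∩ R ∣ + ∣ ∁ P ∩ R ∣ ≡ ∣ R ∣
∣P∩R∣+∣∁P∩R∣≡∣R∣ []            []            = refl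
∣P∩R∣+∣∁P∩R∣≡∣R∣ (inside ∷ P)  (inside ∷ R)  = ≡.cong ℕ.suc (∣P∩R∣+∣∁P∩R∣≡∣R∣ P R)
∣P∩R∣+∣∁P∩R∣≡∣R∣ (outside ∷ P) (inside ∷ R)  =
  ≡.trans (ℕ.+-suc ∣ P ∩ R ∣ ∣ ∁ P ∩ R ∣) (≡.cong ℕ.suc (∣P∩R∣+∣∁P∩R∣≡∣R∣ P R))
∣P∩R∣+∣∁P∩R∣≡∣R∣ (inside ∷ P)  (outside ∷ R) = ∣P∩R∣+∣∁P∩R∣≡∣R∣ P R
∣P∩R∣+∣∁P∩R∣≡∣R∣ (outside ∷ P) (outside ∷ R) = ∣P∩R∣+∣∁P∩R∣≡∣R∣ P R

-- Descent on cardinality: there are finitely many subsets, so one can search for a smaller solution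
-- and stop when none exists.
smallestSubset : {P : Pred (Subset n) p} → Unary.Decidable P → ∃[ D ] P D →
                 ∃[ D ] P D × (∀ E → P E → ∣ D ∣ ≤ ∣ E ∣)
smallestSubset {P = P} P? (D , PD) = descend D PD (<-wellFounded ∣ D ∣)
  where
  descend : ∀ D → P D → Acc _<_ ∣ D ∣ → ∃[ D ] P D × (∀ E → P E → ∣ D ∣ ≤ ∣ E ∣)
  descend D PD (acc rec) with anySubset? (λ E → P? E ×-dec (∣ E ∣ <? ∣ D ∣))
  ... | yes (E , PE , E<D) = descend E PE (rec E<D)
  ... | no ∄E              = D , PD , λ E PE → ℕ.≮⇒≥ λ E<D → ∄E (E , PE , E<D)

-- Decidable predicates on a finite setoid.

module _ {V : Setoid c ℓ} (F : Finite V) where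
  open Setoid V renaming (sym to ≈-sym)
  open Finite F

  element∘index : ∀ v → element (index v) ≈ v
  element∘index = Inverse.strictlyInverseʳ enumeration

  index-injective : ∀ {v w} → index v ≡ index w → v ≈ w
  index-injective = Injection.injective (Inverse⇒Injection enumeration)

  ∈-resp : ∀ (D : Subset size) {v w} → v ≈ w → v ∈ D → w ∈ D
  ∈-resp D v≈w = ≡.subst (_∈ᶠ D) (Inverse.to-cong enumeration v≈w)

  module _ {P : Pred Carrier p} (resp : P Respects _≈_) (P? : Unary.Decidable P) where

    ∃-dec : Dec (∃[ v ] P v)
    ∃-dec = map′ (λ (i , Pi) → element i , Pi)
                 (λ (v , Pv) → index v , resp (≈-sym (element∘index v)) Pv)
                 (any? (P? ∘ element))

    ∀-dec : Dec (∀ v → P v)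
    ∀-dec = map′ (λ ∀P v → resp (element∘index v) (∀P (index v))) (λ ∀P i → ∀P (element i))
                 (all? (P? ∘ element))

    comprehension : Subset size
    comprehension = tabulate λ i → does (P? (element i))

    ∈-comprehension⁺ : ∀ {v} → P v → v ∈ comprehension
    ∈-comprehension⁺ {v} Pv = lookup⇒[]= (index v) comprehension
      (≡.trans (lookup∘tabulate _ (index v))
               (dec-true (P? (element (index v))) (resp (≈-sym (element∘index v)) Pv)))

    ∈-comprehension⁻ : ∀ {v} → v ∈ comprehension → P v
    ∈-comprehension⁻ {v} v∈
      with P? (element (index v)) | ≡.trans (≡.sym (lookup∘tabulate _ (index v))) ([]=⇒lookup v∈)
    ... | yes Pv | _ = resp (element∘index v) Pv
    ... | no _   | ()

-- Images of subsets under a permutation of the setoid.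

module _ {V : Setoid c ℓ} (F : Finite V) (φ : Inverse V V) where
  open Setoid V renaming (sym to ≈-sym)
  open Finite F
  open Inverse φ

  module _ (D : Subset size) where

    private
      from∈D-resp : (λ v → from v ∈ D) Respects _≈_
      from∈D-resp v≈w = ∈-resp F D (from-cong v≈w)

      from∈D? : Unary.Decidable (λ v → from v ∈ D)
      from∈D? v = index (from v) ∈? D

    -- Encoded as a preimage under `from`, so that deciding membership needs no search.
    image : Subset size
    image = comprehension F from∈D-resp from∈D?

    ∈-image⁻ : ∀ {v} → v ∈ image → from v ∈ D
    ∈-image⁻ = ∈-comprehension⁻ F from∈D-resp from∈D?

    ∈-image⁺ : ∀ {v} → v ∈ D → to v ∈ image
    ∈-image⁺ {v} v∈D = ∈-comprehension⁺ F from∈D-resp from∈D?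
      (∈-resp F D (≈-sym (strictlyInverseʳ v)) v∈D)

    image-bijection : Bijection (Members D) (Members image)
    image-bijection = record
      { to        = λ (v , v∈D) → to v , ∈-image⁺ v∈D
      ; cong      = to-cong
      ; bijective = Injection.injective (Inverse⇒Injection φ)
                  , λ (v , v∈im) → (from v , ∈-image⁻ v∈im) , inverseˡ
      }

    ∣image∣≡∣∣ : ∣ image ∣ ≡ ∣ D ∣
    ∣image∣≡∣∣ = ℕ.≤-antisym
      (injection⇒∣∣-mono (index ∘ from ∘ element) (image) D
        (λ {i} → ∈-image⁻ ∘ ≡.subst (_∈ᶠ image) (≡.sym (index∘element i)))
        (λ _ _ → element-injective ∘ from-injective ∘ index-injective F))
      (injection⇒∣∣-mono (index ∘ to ∘ element) D (image)
        (λ {i} → ∈-image⁺ ∘ ≡.subst (_∈ᶠ D) (≡.sym (index∘element i)))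
        (λ _ _ → element-injective ∘ to-injective ∘ index-injective F))
      where
      index∘element : ∀ i → index (element i) ≡ i
      index∘element = Inverse.strictlyInverseˡ enumeration
      element-injective : ∀ {i j} → element i ≈ element j → i ≡ j
      element-injective = Injection.injective (Inverse⇒Injection (Symmetry.inverse enumeration))
      to-injective : ∀ {v w} → to v ≈ to w → v ≈ w
      to-injective = Injection.injective (Inverse⇒Injection φ)
      from-injective : ∀ {v w} → from v ≈ from w → v ≈ w
      from-injective = Injection.injective (Inverse⇒Injection (Symmetry.inverse φ))

-- Graph isomorphisms and sliding automorphisms.

≅-trans : {Γ : Graph c ℓ r} {Δ : Graph c′ ℓ′ r′} {Θ : Graph c″ ℓ″ r″} → Γ ≅ Δ → Δ ≅ Θ → Γ ≅ Θ
≅-trans f g = record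
  { bijection = Compose.inverse (_≅_.bijection f) (_≅_.bijection g)
  ; adjacency = λ u v →
      Compose.equivalence (_≅_.adjacency f u v) (_≅_.adjacency g _ _)
  }

~-cong : (Γ : Graph c ℓ r) → let open Graph Γ in
         ∀ {u u′ v v′} → u ≈ u′ → v ≈ v′ → u ~ v → u′ ~ v′
~-cong Γ u≈u′ v≈v′ = proj₂ ~-resp u≈u′ ∘ proj₁ ~-resp v≈v′
  where open Graph Γ

≅-sym : {Γ : Graph c ℓ r} {Δ : Graph c′ ℓ′ r′} → Γ ≅ Δ → Δ ≅ Γ
≅-sym {Γ = Γ} {Δ = Δ} f = record
  { bijection = Symmetry.inverse bijection
  ; adjacency = λ u v → let u≈ = strictlyInverseˡ u; v≈ = strictlyInverseˡ v in mk⇔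
      (Equivalence.from (adjacency _ _) ∘ ~-cong Δ (Δ.sym u≈) (Δ.sym v≈))
      (~-cong Δ u≈ v≈ ∘ Equivalence.to (adjacency _ _))
  }
  where
  open _≅_ f
  open Inverse bijection
  module Δ = Setoid (Graph.vertices Δ)

-- φ moves all the guards of a configuration at once, taking the one at u to w.
Slidable : Graph c ℓ r → Set _
Slidable Γ = ∀ {u w} → u ~ w → Σ[ φ ∈ Γ ≅ Γ ]
  let open Inverse (_≅_.bijection φ) in to u ≈ w × (∀ v → v ~ to v)
  where open Graph Γ

-- Conjugate the sliding automorphism of `Δ` by `f`.
slidable-transport : {Γ : Graph c ℓ r} {Δ : Graph c′ ℓ′ r′} → Γ ≅ Δ → Slidable Δ → Slidable Γ
slidable-transport {Γ = Γ} {Δ = Δ} f slideΔ {u} {w} u~w =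
  let φ , φu≈w , moves = slideΔ (Equivalence.to (adjacency u w) u~w) in
  ≅-trans f (≅-trans φ (≅-sym f))
  , inverseʳ φu≈w
  , λ v → Equivalence.from (adjacency v _) (proj₁ (Graph.~-resp Δ)
            (Setoid.sym (Graph.vertices Δ) (strictlyInverseˡ _)) (moves (to v)))
  where
  open _≅_ f
  open Inverse bijection

-- Domination against eternal domination.

module _ (Γ : Graph c ℓ r) where
  open Graph Γ
  open Setoid vertices using () renaming (refl to ≈-refl; sym to ≈-sym; trans to ≈-trans)

  Dominates-cong : ∀ {u u′ w w′} → u ≈ u′ → w ≈ w′ → Dominates Γ u w → Dominates Γ u′ w′
  Dominates-cong u≈u′ w≈w′ = Sum.map
    (λ w≈u → ≈-trans (≈-sym w≈w′) (≈-trans w≈u u≈u′)) (~-cong Γ u≈u′ w≈w′)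

  dominating? : Decidable _~_ → Unary.Decidable (IsDominating Γ)
  dominating? _~?_ D = ∀-dec finite
    (λ w≈w′ (u , u∈D , dom) → u , u∈D , Dominates-cong ≈-refl w≈w′ dom)
    (λ w → ∃-dec finite
      (λ u≈u′ (u∈D , dom) → ∈-resp finite D u≈u′ u∈D , Dominates-cong u≈u′ ≈-refl dom)
      (λ u → (index u ∈? D) ×-dec ((w ≟ u) ⊎-dec (u ~? w))))

  ⊤-dominating : IsDominating Γ ⊤
  ⊤-dominating w = w , ∈⊤ , inj₁ ≈-refl

  -- The guard that answers an attack on `w` started at `w` or at a neighbour of `w`. This yields
  -- the bound γ ≤ γ^∞_all.
  eternal⇒dominating : ∀ D → IsEternalDominating Γ D → IsDominating Γ D
  eternal⇒dominating D (𝒟 , conf , D∈𝒟) w with index w ∈? D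
  ... | yes w∈D = w , w∈D , inj₁ ≈-refl
  ... | no  w∉D =
    let D′ , _ , w∈D′ , f , moves = IsEternalDominatingConfiguration.defends conf D D∈𝒟 w w∉D
        (d , d∈D) , f⟨d⟩≈w        = Bijection.surjective f (w , w∈D′)
        eq                        = f⟨d⟩≈w ≈-refl
    in d , d∈D , Dominates-cong ≈-refl eq (moves (d , d∈D))

  module _ (φ : Γ ≅ Γ) where
    open _≅_ φ
    open Inverse bijection

    image-dominating : ∀ D → IsDominating Γ D → IsDominating Γ (image finite bijection D)
    image-dominating D dom w =
      let u , u∈D , u→w = dom (from w) in
      to u , ∈-image⁺ finite bijection D u∈D
      , Dominates-cong ≈-refl (strictlyInverseˡ w)
          (Sum.map to-cong (Equivalence.to (adjacency u (from w))) u→w)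

  module _ (_~?_ : Decidable _~_) (slide : Slidable Γ) where

    -- Dominance is taken through its decision to bring it down to level 0.
    DominatingOfSize : ℕ → Pred VertexSet _
    DominatingOfSize k D = True (dominating? _~?_ D) × ∣ D ∣ ≡ k

    -- An automorphism preserves domination and size, so the slid set stays in the family. Sliding
    -- along the edge from a dominator `u` to the attacked `w` puts a guard on `w`.
    dominatingOfSize-eternal : ∀ {k D} → DominatingOfSize k D →
                               IsEternalDominatingConfiguration Γ (DominatingOfSize k)
    dominatingOfSize-eternal {k} {D₀} D₀∈ = record
      { nonempty        = D₀ , D₀∈
      ; sameCardinality = λ D E (_ , ∣D∣≡k) (_ , ∣E∣≡k) → ≡.trans ∣D∣≡k (≡.sym ∣E∣≡k)
      ; defends         = defends
      }
      where
      defends : ∀ D → DominatingOfSize k D → ∀ w → w ∉ D →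
                ∃[ D′ ] DominatingOfSize k D′ × w ∈ D′ × CanReconfigure Γ D D′
      defends D (dom , ∣D∣≡k) w w∉D with toWitness dom w
      ... | u , u∈D , inj₁ w≈u = contradiction (∈-resp finite D (≈-sym w≈u) u∈D) w∉D
      ... | u , u∈D , inj₂ u~w =
        let φ , φu≈w , moves = slide u~w
            β                = _≅_.bijection φ
            φD               = image finite β D
        in φD
         , (fromWitness (image-dominating φ D (toWitness dom))
           , ≡.trans (∣image∣≡∣∣ finite β D) ∣D∣≡k)
         , ∈-resp finite φD φu≈w (∈-image⁺ finite β D u∈D)
         , image-bijection finite β D , λ (v , _) → inj₂ (moves v)

    -- One smallest dominating set attains both minima: it is itself eternal, and every eternal
    -- dominating set is dominating.
    γ∞≡γ : ∃[ k ] IsEternalDominationNumber Γ k × IsDominationNumber Γ k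
    γ∞≡γ =
      let D , dom , least = smallestSubset (dominating? _~?_) (⊤ , ⊤-dominating)
          D∈              = fromWitness dom , refl
      in ∣ D ∣
       , ((D , (_ , dominatingOfSize-eternal D∈ , D∈) , refl)
         , λ E → least E ∘ eternal⇒dominating E)
       , (D , dom , refl) , least

-- Adjacency in Cayley graphs.

module _ (G : Group c ℓ) (F : Finite (Group.setoid G))
         (S : Subset (Finite.size F)) (S-inv : InverseClosed G F S) where
  open Group G
  open Finite F
  open Graph (Cay G F S S-inv) using (_~_)

  -- The label of an edge is forced by its ends, so adjacency reduces to one decidable membership.
  Cay-~ : ∀ u v → u ~ v ⇔ u ⁻¹ ∙ v ∈ S
  Cay-~ u v = mk⇔
    (λ (s , s∈S , v≈us) → ∈-resp F S
      (sym (trans (∙-congˡ v≈us) (GroupProperties.\\-leftDividesʳ G u s))) s∈S)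
    (λ d∈S → u ⁻¹ ∙ v , d∈S , sym (GroupProperties.\\-leftDividesˡ G u v))

  Cay-~? : Decidable _~_
  Cay-~? u v = map′ (Equivalence.from (Cay-~ u v)) (Equivalence.to (Cay-~ u v)) (index (u ⁻¹ ∙ v) ∈? S)

  ∈S-inv⇔ : ∀ u v → u ⁻¹ ≈ v → u ∈ S ⇔ v ∈ S
  ∈S-inv⇔ u v u⁻¹≈v = mk⇔
    (∈-resp F S u⁻¹≈v ∘ S-inv u)
    (∈-resp F S (trans (⁻¹-cong (sym u⁻¹≈v)) (GroupProperties.⁻¹-involutive G u)) ∘ S-inv v)

-- Translations of abelian Cayley graphs.

module _ (A : AbelianGroup c ℓ) (F : Finite (AbelianGroup.setoid A))
         (S : Subset (Finite.size F)) (S-inv : InverseClosed (AbelianGroup.group A) F S) where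
  open AbelianGroup A renaming (refl to ≈-refl)
  open AbelianGroupProperties A using (//-rightDividesˡ; //-rightDividesʳ; ∙-cancelʳ)
  open CommutativeSemigroupProperties commutativeSemigroup using (xy∙z≈xz∙y)

  translation : Carrier → Inverse setoid setoid
  translation s = record
    { to        = _∙ s
    ; from      = _∙ s ⁻¹
    ; to-cong   = ∙-congʳ
    ; from-cong = ∙-congʳ
    ; inverse   = (λ y≈ → trans (∙-congʳ y≈) (//-rightDividesˡ s _))
                , (λ y≈ → trans (∙-congʳ y≈) (//-rightDividesʳ s _))
    }

  -- Right multiplication by `s` follows the edges labelled `s`. Commutativity makes it an
  -- automorphism that keeps every edge label.
  Cay-slidable : Slidable (Cay group F S S-inv)
  Cay-slidable {u} {w} (s , s∈S , w≈us) = record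
    { bijection = translation s
    ; adjacency = λ u v → mk⇔
        (λ (t , t∈S , v≈ut) → t , t∈S , trans (∙-congʳ v≈ut) (xy∙z≈xz∙y u t s))
        (λ (t , t∈S , vs≈ust) → t , t∈S , ∙-cancelʳ s v (u ∙ t) (trans vs≈ust (xy∙z≈xz∙y u s t)))
    } , sym w≈us , λ v → s , s∈S , ≈-refl

-- The coset `xA` and the centre of its part in `S`.

module _ (A : AbelianGroup c ℓ) (F : Finite (AbelianGroup.setoid A)) where
  open AbelianGroup A renaming (Carrier to ∣A∣; refl to ≈-refl; sym to ≈-sym; trans to ≈-trans)
  open AbelianGroupProperties A
    using (//-rightDividesˡ; //-rightDividesʳ; ⁻¹-∙-comm; ⁻¹-involutive; identityˡ-unique; ε⁻¹≈ε)
  open CommutativeSemigroupProperties commutativeSemigroup using (xy∙z≈y∙xz)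

  private
    module F  = Finite F
    G         = GenDihedral A
    module G  = Group G
    H         = AbelianGroup.group (A×C₂ A)
    module H  = Group H
    G-finite  = GenDihedral-finite A F
    H-finite  = A×C₂-finite A F
    module GF = Finite G-finite
    module HF = Finite H-finite
    X         = xA A F

    inCoset : G.Carrier → Set _
    inCoset v = ∃[ j ] v G.≈ x A G.∙ ι A (F.element j)

    inCoset-resp : inCoset Respects G._≈_
    inCoset-resp v≈w (j , v≈) = j , G.trans (G.sym v≈w) v≈

    inCoset? : Unary.Decidable inCoset
    inCoset? v = any? λ j → v GF.≟ x A G.∙ ι A (F.element j)

  xA⁺ : ∀ a → (a , 1ℙ) GF.∈ X
  xA⁺ a = ∈-comprehension⁺ G-finite inCoset-resp inCoset?
    -- The product of `x` and `ι b` has `A`-part `ε ∙ b ⁻¹`, so the witness must be `a ⁻¹`.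
    (F.index (a ⁻¹) , (let open SetoidReasoning setoid in begin
      a                                 ≈⟨ ⁻¹-involutive a ⟨
      (a ⁻¹) ⁻¹                         ≈⟨ ⁻¹-cong (element∘index F (a ⁻¹)) ⟨
      F.element (F.index (a ⁻¹)) ⁻¹     ≈⟨ identityˡ _ ⟨
      ε ∙ F.element (F.index (a ⁻¹)) ⁻¹ ∎) , refl)

  xA⁻ : ∀ {v} → v GF.∈ X → proj₂ v ≡ 1ℙ
  xA⁻ v∈X = proj₂ (proj₂ (∈-comprehension⁻ G-finite inCoset-resp inCoset? v∈X))

  -- All elements of the coset have parity `1ℙ`, so the `A`-part determines them.
  ∣xA∣≤∣A∣ : ∣ X ∣ ≤ F.size
  ∣xA∣≤∣A∣ = ≡.subst (∣ X ∣ ≤_) (∣⊤∣≡n F.size)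
    (injection⇒∣∣-mono (F.index ∘ proj₁ ∘ GF.element) X ⊤ (λ _ → ∈⊤) λ {i} {j} i∈X j∈X eq →
      Injection.injective (Inverse⇒Injection (Symmetry.inverse GF.enumeration))
        (index-injective F eq , ≡.trans (parity i∈X) (≡.sym (parity j∈X))))
    where
    parity : ∀ {i} → i ∈ᶠ X → proj₂ (GF.element i) ≡ 1ℙ
    parity {i} i∈X = xA⁻ (≡.subst (_∈ᶠ X) (≡.sym (Inverse.strictlyInverseˡ GF.enumeration i)) i∈X)

  -- Elements of `xA` are involutions in the dihedral group but not in general in `A × C₂`.
  -- Inverse-closure there asks that the `A`-part of `S ∩ xA`, divided by `t`, be closed under
  -- inversion.
  SymmetricAbout : ∣A∣ → Subset GF.size → Set _
  SymmetricAbout t S = ∀ b → (b ∙ t , 1ℙ) GF.∈ S → (b ⁻¹ ∙ t , 1ℙ) GF.∈ S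

  ∃-centre : ∀ S → ∣ S ∩ X ∣ ≤ 1 → ∃[ t ] SymmetricAbout t S
  ∃-centre S ≤1 with nonempty? (S ∩ X)
  -- The condition is vacuous here, so `ε` is an arbitrary choice.
  ... | no  empty       = ε , λ b b∈S → contradiction (_ , x∈p∩q⁺ (b∈S , xA⁺ _)) empty
  ... | yes (i , i∈S∩X) = t , symmetric
    where
    -- With the only element of `S ∩ xA` as centre, `b ∙ t` can only be `t`, so `b` is the identity
    -- and equals its inverse.
    t = proj₁ (GF.element i)
    symmetric : SymmetricAbout t S
    symmetric b bt∈S = ∈-resp G-finite S (∙-congʳ b≈b⁻¹ , refl) bt∈S
      where
      bt≈t : b ∙ t ≈ t
      bt≈t = proj₁ (G.trans
        (G.sym (element∘index G-finite (b ∙ t , 1ℙ)))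
        (G.reflexive (≡.cong GF.element (∣P∣≤1⇒unique ≤1 (x∈p∩q⁺ (bt∈S , xA⁺ _)) i∈S∩X))))
      b≈b⁻¹ : b ≈ b ⁻¹
      b≈b⁻¹ = let b≈ε = identityˡ-unique b t bt≈t in
              ≈-trans b≈ε (≈-trans (≈-sym ε⁻¹≈ε) (≈-sym (⁻¹-cong b≈ε)))

  -- Inversion is an involution, so a set is closed under it as soon as its complement is.
  ∁-symmetric : ∀ {t} S → SymmetricAbout t (∁ S) → SymmetricAbout t S
  ∁-symmetric {t} S sym b bt∈S = decidable-stable (_ ∈? S) λ b⁻¹t∉S →
    x∈∁p⇒x∉p (∈-resp G-finite (∁ S) (∙-congʳ (⁻¹-involutive b) , refl)
                 (sym (b ⁻¹) (x∉p⇒x∈∁p b⁻¹t∉S))) bt∈S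

  ∣∁S∩xA∣≤1 : ∀ S → ∣ S ∩ X ∣ ≥ F.size ∸ 1 → ∣ ∁ S ∩ X ∣ ≤ 1
  ∣∁S∩xA∣≤1 S ≥n-1 = ℕ.+-cancelˡ-≤ (F.size ∸ 1) _ _ (let open ℕ.≤-Reasoning in begin
      F.size ∸ 1 + ∣ ∁ S ∩ X ∣ ≤⟨ ℕ.+-monoˡ-≤ _ ≥n-1 ⟩
      ∣ S ∩ X ∣ + ∣ ∁ S ∩ X ∣  ≡⟨ ∣P∩R∣+∣∁P∩R∣≡∣R∣ S X ⟩
      ∣ X ∣                    ≤⟨ ∣xA∣≤∣A∣ ⟩
      -- This direction is safe for truncated subtraction.
      F.size                   ≤⟨ ℕ.m≤n+m∸n F.size 1 ⟩
      1 + (F.size ∸ 1)         ≡⟨ ℕ.+-comm 1 _ ⟩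
      F.size ∸ 1 + 1           ∎)

  -- The isomorphism onto a Cayley graph on `A × C₂`.

  module _ (S : Subset GF.size) (S-inv : InverseClosed G G-finite S)
           (t : ∣A∣) (symmetric : SymmetricAbout t S) where

    -- Fixes `A` and shifts the other coset so that the centre `(t , 1ℙ)` goes to `(ε , 1ℙ)`.
    straighten : Inverse G.setoid H.setoid
    straighten = record
      { to        = λ { (a , 0ℙ) → a , 0ℙ ; (a , 1ℙ) → a ∙ t ⁻¹ , 1ℙ }
      ; from      = λ { (a , 0ℙ) → a , 0ℙ ; (a , 1ℙ) → a ∙ t , 1ℙ }
      ; to-cong   = λ { {_ , 0ℙ} (a≈b , refl) → a≈b , refl
                      ; {_ , 1ℙ} (a≈b , refl) → ∙-congʳ a≈b , refl }
      ; from-cong = λ { {_ , 0ℙ} (a≈b , refl) → a≈b , refl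
                      ; {_ , 1ℙ} (a≈b , refl) → ∙-congʳ a≈b , refl }
      ; inverse   =
          (λ { {_ , 0ℙ} (a≈b , refl) → a≈b , refl
             ; {b , 1ℙ} (a≈b , refl) → ≈-trans (∙-congʳ a≈b) (//-rightDividesʳ t b) , refl })
        , (λ { {_ , 0ℙ} (a≈b , refl) → a≈b , refl
             ; {b , 1ℙ} (a≈b , refl) → ≈-trans (∙-congʳ a≈b) (//-rightDividesˡ t b) , refl })
      }

    open Inverse straighten

    private
      T-resp : (λ v → from v GF.∈ S) Respects H._≈_
      T-resp v≈w = ∈-resp G-finite S (from-cong v≈w)

      T? : Unary.Decidable (λ v → from v GF.∈ S)
      T? v = GF.index (from v) ∈? S

    T : Subset HF.size
    T = comprehension H-finite T-resp T?

    -- On `A` the inverses of the two groups agree; on the other coset the claim is exactly the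
    -- symmetry about `t`.
    T-inv : InverseClosed H H-finite T
    T-inv (b , i) b∈T = ∈-comprehension⁺ H-finite T-resp T?
      (reflect i (∈-comprehension⁻ H-finite T-resp T? b∈T))
      where
      reflect : ∀ i → from (b , i) GF.∈ S → from ((b , i) H.⁻¹) GF.∈ S
      reflect 0ℙ = S-inv (b , 0ℙ)
      reflect 1ℙ = symmetric b

    private
      Γ = Cay G G-finite S S-inv
      Δ = Cay H H-finite T T-inv
      module Γ = Graph Γ
      module Δ = Graph Δ

      -- It remains to compare, for each pair of parities, the quotients of the ends in the two
      -- groups.
      edge⇔ : ∀ u v → (u G.⁻¹ G.∙ v GF.∈ S ⇔ from (to u H.⁻¹ H.∙ to v) GF.∈ S) →
              u Γ.~ v ⇔ to u Δ.~ to v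
      edge⇔ u v S⇔S = Compose.equivalence (Compose.equivalence (Cay-~ G G-finite S S-inv u v) S⇔S)
        (Compose.equivalence
          (mk⇔ (∈-comprehension⁺ H-finite T-resp T? {to u H.⁻¹ H.∙ to v})
               (∈-comprehension⁻ H-finite T-resp T? {to u H.⁻¹ H.∙ to v}))
          (Symmetry.equivalence (Cay-~ H H-finite T T-inv (to u) (to v))))

      cross : ∀ a b → (a , 0ℙ) Γ.~ (b , 1ℙ) ⇔ to (a , 0ℙ) Δ.~ to (b , 1ℙ)
      cross a b = edge⇔ (a , 0ℙ) (b , 1ℙ)
        (mk⇔ (∈-resp G-finite S (eq , refl)) (∈-resp G-finite S (≈-sym eq , refl)))
        where
        eq : a ⁻¹ ∙ b ≈ (a ⁻¹ ∙ (b ∙ t ⁻¹)) ∙ t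
        eq = ≈-trans (∙-congˡ (≈-sym (//-rightDividesˡ t b))) (≈-sym (assoc _ _ _))

    straighten-adjacency : ∀ u v → u Γ.~ v ⇔ to u Δ.~ to v
    straighten-adjacency (a , 0ℙ) (b , 0ℙ) = edge⇔ (a , 0ℙ) (b , 0ℙ) (mk⇔ (λ d → d) (λ d → d))
    straighten-adjacency (a , 0ℙ) (b , 1ℙ) = cross a b
    -- Reversing the edge reduces this to `cross`.
    straighten-adjacency (a , 1ℙ) (b , 0ℙ) = mk⇔
      (Δ.~-sym {b , 0ℙ} {a ∙ t ⁻¹ , 1ℙ} ∘ Equivalence.to (cross b a) ∘ Γ.~-sym {a , 1ℙ} {b , 0ℙ})
      (Γ.~-sym {b , 0ℙ} {a , 1ℙ} ∘ Equivalence.from (cross b a) ∘ Δ.~-sym {a ∙ t ⁻¹ , 1ℙ} {b , 0ℙ})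
    -- The shift by `t` cancels, but the two quotients are a b⁻¹ and a⁻¹ b. They are mutually
    -- inverse, so the inverse-closure of `S` identifies the edges.
    straighten-adjacency (a , 1ℙ) (b , 1ℙ) = edge⇔ (a , 1ℙ) (b , 1ℙ)
      (∈S-inv⇔ G G-finite S S-inv _ _ (eq , refl))
      where
      eq : (a ⁻¹ ⁻¹ ∙ b ⁻¹) ⁻¹ ≈ (a ∙ t ⁻¹) ⁻¹ ∙ (b ∙ t ⁻¹)
      eq = let open SetoidReasoning setoid in begin
        (a ⁻¹ ⁻¹ ∙ b ⁻¹) ⁻¹           ≈⟨ ⁻¹-cong (⁻¹-∙-comm (a ⁻¹) b) ⟩
        (a ⁻¹ ∙ b) ⁻¹ ⁻¹              ≈⟨ ⁻¹-involutive _ ⟩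
        -- Reinsert the shift as `t ⁻¹ ⁻¹ ∙ t ⁻¹`.
        a ⁻¹ ∙ b                      ≈⟨ ∙-congˡ (//-rightDividesˡ (t ⁻¹) b) ⟨
        a ⁻¹ ∙ ((b ∙ t ⁻¹ ⁻¹) ∙ t ⁻¹) ≈⟨ ∙-congˡ (xy∙z≈y∙xz _ _ _) ⟩
        a ⁻¹ ∙ (t ⁻¹ ⁻¹ ∙ (b ∙ t ⁻¹)) ≈⟨ assoc _ _ _ ⟨
        (a ⁻¹ ∙ t ⁻¹ ⁻¹) ∙ (b ∙ t ⁻¹) ≈⟨ ∙-congʳ (⁻¹-∙-comm a (t ⁻¹)) ⟩
        (a ∙ t ⁻¹) ⁻¹ ∙ (b ∙ t ⁻¹)    ∎

    straighten-≅ : Γ ≅ Δ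
    straighten-≅ = record { bijection = straighten ; adjacency = straighten-adjacency }

corollary3p5 :
  ∀ {c ℓ : Level} (A : AbelianGroup c ℓ) (A-finite : Finite (AbelianGroup.setoid A)) →
  let n = Finite.size A-finite
      G = GenDihedral A
      G-finite = GenDihedral-finite A A-finite
      H = AbelianGroup.group (A×C₂ A)
      H-finite = A×C₂-finite A A-finite
  in
  (S : Subset (Finite.size G-finite)) (S-inv : InverseClosed G G-finite S) →
  (∣ S ∩ xA A A-finite ∣ ≤ 1) ⊎ (∣ S ∩ xA A A-finite ∣ ≥ n ∸ 1) →
  let Γ = Cay G G-finite S S-inv in
  (Σ[ T ∈ Subset (Finite.size H-finite) ] Σ[ T-inv ∈ InverseClosed H H-finite T ]
     Γ ≅ Cay H H-finite T T-inv)
  ×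
  (∃[ k ] IsEternalDominationNumber Γ k × IsDominationNumber Γ k)
corollary3p5 A A-finite S S-inv small-or-large =
  let G = GenDihedral A
      G-finite = GenDihedral-finite A A-finite
      H-finite = A×C₂-finite A A-finite
      t , symmetric = centre small-or-large
      T′     = T A A-finite S S-inv t symmetric
      T-inv′ = T-inv A A-finite S S-inv t symmetric
      Γ≅Δ    = straighten-≅ A A-finite S S-inv t symmetric
  in (T′ , T-inv′ , Γ≅Δ)
   , γ∞≡γ (Cay G G-finite S S-inv) (Cay-~? G G-finite S S-inv)
       (slidable-transport Γ≅Δ (Cay-slidable (A×C₂ A) H-finite T′ T-inv′))
  where
  centre : (∣ S ∩ xA A A-finite ∣ ≤ 1) ⊎ (∣ S ∩ xA A A-finite ∣ ≥ Finite.size A-finite ∸ 1) →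
           ∃[ t ] SymmetricAbout A A-finite t S
  centre (inj₁ ≤1)   = ∃-centre A A-finite S ≤1
  -- `S` misses at most one element of `xA`, so a centre of the complement serves for `S`.
  centre (inj₂ ≥n-1) =
    let t , symmetric = ∃-centre A A-finite (∁ S) (∣∁S∩xA∣≤1 A A-finite S ≥n-1) in
    t , ∁-symmetric A A-finite S symmetric
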